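{- Let $\mathsf{L}$ be any of the logics $\mathbf{PT}_0$, $\mathbf{PD}$, $\mathbf{PD}^{\vee}$, $\mathbf{InqL}$, $\mathbf{PID}$. Then $\mathsf{L}$ is expressively complete: for every finite nonempty set $N=\{i_1,\dots,i_n\}\subseteq\mathbb{N}$, $$\nabla_N=\{\llbracket\phi\rrbracket_N : \phi \text{ is a formula in the language of } \mathsf{L} \text{ whose propositional variables are among } p_{i_1},\dots,p_{i_n}\}.$$ In particular $\mathbf{PT}_0\equiv\mathbf{PD}\equiv\mathbf{PD}^{\vee}\equiv\mathbf{InqL}\equiv\mathbf{PID}$, i.e. for any two of these logics $\mathsf{L}_1,\mathsf{L}_2$, every formula in the language of $\mathsf{L}_1$ is semantically equivalent to a formula in the language of $\mathsf{L}_2$ and vice versa.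
   Context: Propositional variables are $p_i$, $i\in\mathbb{N}$. A valuation is a function $s:\mathbb{N}\to\{0,1\}$; a team is a set of valuations. For $N\subseteq\mathbb{N}$ finite, a valuation on $N$ is a function $N\to\{0,1\}$, $2^N$ is the set of all of these, and a team on $N$ is a subset of $2^N$. Formulas of $\mathbf{PT}_0$ are given by $$\phi::=p_i\mid\neg p_i\mid\bot\mid\mathop{=}(p_{i_1},\dots,p_{i_k},p_j)\mid(\phi\wedge\phi)\mid(\phi\otimes\phi)\mid(\phi\vee\phi)\mid(\phi\to\phi),$$ where $k\ge 0$ (for $k=0$ the dependence atom is $\mathop{=}(p_j)$). Truth on a team $X$ is defined by: - $X\models p_i$ iff $s(i)=1$ for all $s\in X$; $X\models\neg p_i$ iff $s(i)=0$ for all $s\in X$; $X\models\bot$ iff $X=\emptyset$; - $X\models\mathop{=}(p_{i_1},\dots,p_{i_k},p_j)$ iff for all $s,s'\in X$, if $s(i_1)=s'(i_1),\dots,s(i_k)=s'(i_k)$ then $s(j)=s'(j)$; - $X\models\phi\wedge\psi$ iff $X\models\phi$ and $X\models\psi$; - $X\models\phi\otimes\psi$ iff there are $Y,Z\subseteq X$ with $X=Y\cup Z$, $Y\models\phi$ and $Z\models\psi$; - $X\models\phi\vee\psi$ iff $X\models\phi$ or $X\models\psi$; - $X\models\phi\to\psi$ iff for all $Y\subseteq X$, $Y\models\phi$ implies $Y\models\psi$. The same clauses define $X\models\phi$ for teams $X$ on $N$ when all variables of $\phi$ have indices in $N$. Formulas $\phi,\psi$ are semantically equivalent if they are true on the same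 teams. The sublanguages are: $\mathbf{PD}$: atoms $p_i,\neg p_i,\bot,\mathop{=}(p_{i_1},\dots,p_{i_k},p_j)$, connectives $\wedge,\otimes$. $\mathbf{PD}^{\vee}$: atoms $p_i,\neg p_i,\bot$, connectives $\wedge,\otimes,\vee$. $\mathbf{PID}$: atoms $p_i,\bot,\mathop{=}(p_{i_1},\dots,p_{i_k},p_j)$, connectives $\wedge,\vee,\to$. $\mathbf{InqL}$: atoms $p_i,\bot$, connectives $\wedge,\vee,\to$. $\llbracket\phi\rrbracket_N:=\{X\subseteq 2^N : X\models\phi\}$, and $\nabla_N$ is the family of all nonempty downward closed collections of teams on $N$: $$\nabla_N=\{\mathcal{K}\subseteq \mathcal{P}(2^N) : \mathcal{K}\ne\emptyset\text{ and }(Y\subseteq X\in\mathcal{K}\Rightarrow Y\in\mathcal{K})\}.$$ -}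

module Defs where

open import Data.Bool.Base using (Bool; true; false)
open import Data.List.Base using (List; []; _∷_)
open import Data.List.Membership.Propositional using () renaming (_∈_ to _∈ˡ_)
open import Data.List.Relation.Unary.All using (All)
open import Data.List.Relation.Unary.Unique.Propositional using (Unique)
open import Data.Nat.Base using (ℕ)
open import Data.Product.Base using (∃-syntax; _×_)
open import Data.Sum.Base using (_⊎_)
open import Function.Bundles using (_⇔_)
open import Level using (0ℓ; Lift) renaming (suc to lsuc)
open import Relation.Binary.Definitions using (_Respects_)
open import Relation.Binary.PropositionalEquality using (_≡_; _≢_; _≗_)
open import Relation.Unary using (Pred; _∈_; _⊆_; _≐_; _∪_; Empty; Satisfiable)

infix  4 _⊨_ _⊆ₜ_ _≡ₛ_ _≡ᴸ_ _inLang_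
infixr 7 _∧_
infixr 6 _⊗_ _∨_
infixr 5 _⇒_

-- Formulas and truth are defined over an arbitrary set I of indices, since the
-- same clauses serve for teams (I = ℕ) and for teams on a set N (I = Elem N).
-- `Formula I` consists of the formulas all of whose variables have index in I.

data Formula (I : Set) : Set where
  var  : I → Formula I
  ¬var : I → Formula I
  bot  : Formula I
  dep  : List I → I → Formula I
  _∧_  : Formula I → Formula I → Formula I
  _⊗_  : Formula I → Formula I → Formula I
  _∨_  : Formula I → Formula I → Formula I
  _⇒_  : Formula I → Formula I → Formula I

Elem : List ℕ → Set
Elem N = ∃[ i ] i ∈ˡ N

Valuation : Set → Set
Valuation I = I → Bool

-- Without function extensionality, pointwise equal valuations need not be
-- propositionally equal; a set of valuations must not distinguish them.

record Team (I : Set) : Set₁ where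
  constructor mkTeam
  field
    members : Pred (Valuation I) 0ℓ
    resp    : members Respects _≗_

open Team public

_⊆ₜ_ : {I : Set} → Team I → Team I → Set
Y ⊆ₜ X = members Y ⊆ members X

-- `Lift` only adjusts the universe level: the clauses for ⊗ and ⇒ quantify
-- over teams and therefore live in Set₁.

_⊨_ : {I : Set} → Team I → Formula I → Set₁
X ⊨ var i    = Lift (lsuc 0ℓ) (∀ s → s ∈ members X → s i ≡ true)
X ⊨ ¬var i   = Lift (lsuc 0ℓ) (∀ s → s ∈ members X → s i ≡ false)
X ⊨ bot      = Lift (lsuc 0ℓ) (Empty (members X))
X ⊨ dep is j = Lift (lsuc 0ℓ) (∀ s s′ → s ∈ members X → s′ ∈ members X →
                               All (λ i → s i ≡ s′ i) is → s j ≡ s′ j)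
X ⊨ φ ∧ ψ    = X ⊨ φ × X ⊨ ψ
X ⊨ φ ⊗ ψ    = ∃[ Y ] ∃[ Z ] Y ⊆ₜ X × Z ⊆ₜ X ×
               members X ≐ (members Y ∪ members Z) × Y ⊨ φ × Z ⊨ ψ
X ⊨ φ ∨ ψ    = X ⊨ φ ⊎ X ⊨ ψ
X ⊨ φ ⇒ ψ    = ∀ Y → Y ⊆ₜ X → Y ⊨ φ → Y ⊨ ψ

⟦_⟧ : {I : Set} → Formula I → Pred (Team I) (lsuc 0ℓ)
⟦ φ ⟧ X = X ⊨ φ

_≡ₛ_ : Formula ℕ → Formula ℕ → Set₁
φ ≡ₛ ψ = (X : Team ℕ) → X ⊨ φ ⇔ X ⊨ ψ

data Symbol : Set where
  `var `¬var `bot `dep `∧ `⊗ `∨ `⇒ : Symbol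

data Logic : Set where
  PT₀ PD PD∨ InqL PID : Logic

symbols : Logic → List Symbol
symbols PT₀  = `var ∷ `¬var ∷ `bot ∷ `dep ∷ `∧ ∷ `⊗ ∷ `∨ ∷ `⇒ ∷ []
symbols PD   = `var ∷ `¬var ∷ `bot ∷ `dep ∷ `∧ ∷ `⊗ ∷ []
symbols PD∨  = `var ∷ `¬var ∷ `bot ∷ `∧ ∷ `⊗ ∷ `∨ ∷ []
symbols InqL = `var ∷ `bot ∷ `∧ ∷ `∨ ∷ `⇒ ∷ []
symbols PID  = `var ∷ `bot ∷ `dep ∷ `∧ ∷ `∨ ∷ `⇒ ∷ []

_inLang_ : {I : Set} → Formula I → Logic → Set
var _   inLang L = `var ∈ˡ symbols L
¬var _  inLang L = `¬var ∈ˡ symbols L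
bot     inLang L = `bot ∈ˡ symbols L
dep _ _ inLang L = `dep ∈ˡ symbols L
φ ∧ ψ   inLang L = `∧ ∈ˡ symbols L × φ inLang L × ψ inLang L
φ ⊗ ψ   inLang L = `⊗ ∈ˡ symbols L × φ inLang L × ψ inLang L
φ ∨ ψ   inLang L = `∨ ∈ˡ symbols L × φ inLang L × ψ inLang L
φ ⇒ ψ   inLang L = `⇒ ∈ˡ symbols L × φ inLang L × ψ inLang L

-- Downward closure also makes 𝒦 invariant under extensional equality of teams.

∇ : (N : List ℕ) → Pred (Pred (Team (Elem N)) (lsuc 0ℓ)) (lsuc 0ℓ)
∇ N 𝒦 = Satisfiable 𝒦 × (∀ X Y → Y ⊆ₜ X → X ∈ 𝒦 → Y ∈ 𝒦)

Definable : Logic → (N : List ℕ) → Pred (Pred (Team (Elem N)) (lsuc 0ℓ)) (lsuc 0ℓ)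
Definable L N 𝒦 = ∃[ φ ] φ inLang L × 𝒦 ≐ ⟦ φ ⟧

-- A finite set N ⊆ ℕ is given by a repetition-free enumeration.

ExpressivelyComplete : Logic → Set₂
ExpressivelyComplete L =
  (N : List ℕ) → Unique N → N ≢ [] → ∇ N ≐ Definable L N

_≡ᴸ_ : Logic → Logic → Set₁
L₁ ≡ᴸ L₂ =
  ((φ : Formula ℕ) → φ inLang L₁ → ∃[ ψ ] ψ inLang L₂ × φ ≡ₛ ψ) ×
  ((ψ : Formula ℕ) → ψ inLang L₂ → ∃[ φ ] φ inLang L₁ × ψ ≡ₛ φ)

{-# OPTIONS --safe #-}
module Submission where

-- Truth of φ in X depends only on which bit vectors s ↾ N occur for s ∈ X, as
-- soon as N contains the variables of φ. So a definable family 𝒦 is `Local`: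
-- it is closed under passing from X to any Y all of whose vectors occur in X.
-- Conversely a nonempty local family is determined by the finitely many sets T
-- of bit vectors whose team [ T ] belongs to it, and is defined by
--
--   ⋁ { "X ⊆ [ T ]" : [ T ] ∈ 𝒦 }        in PD∨ and InqL (so in PT₀ and PID),
--   ⋀ { "X misses a v ∈ T" : [ T ] ∉ 𝒦 }  in PD,
--
-- where X misses a vector of T iff X splits into a part with fewer than |T|
-- vectors and a part disjoint from T; a team with at most k vectors is a ⊗ of k
-- teams on which every variable of N is constant. Locality is preferred to
-- downward closure since it covers both teams on N and, with N the list of
-- variables of φ, teams on ℕ.

open import Axiom.ExcludedMiddle using (ExcludedMiddle)
open import Data.Bool.Base using (Bool; true; false)
open import Data.Bool.Properties using (¬-not; not-¬) renaming (_≟_ to _≟ᵇ_)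
open import Data.List.Base using (List; []; _∷_; [_]; _++_; map; foldr; filter; length; deduplicate)
open import Data.List.Membership.Propositional using () renaming (_∈_ to _∈ˡ_; _∉_ to _∉ˡ_)
open import Data.List.Membership.Propositional.Properties
  using (∈-map⁺; ∈-++⁺ˡ; ∈-++⁺ʳ; ∈-++⁻; ∈-∃++; ∈-filter⁺; ∈-filter⁻;
         ∈-deduplicate⁺; ∈-deduplicate⁻)
open import Data.List.Properties using (length-++-sucʳ)
open import Data.List.Relation.Unary.All as All using (All; []; _∷_)
open import Data.List.Relation.Unary.Any using (here; there)
open import Data.List.Relation.Unary.Unique.DecPropositional.Properties using (deduplicate-!)
open import Data.List.Relation.Unary.Unique.Propositional using (Unique; []; _∷_)
open import Data.Nat.Base using (ℕ; zero; suc; pred; _≤_; z≤n; s≤s)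
open import Data.Nat.Properties using (1+n≰n; ≤-reflexive; ≤-trans)
open import Data.Product.Base using (_×_; _,_; proj₁; proj₂; ∃-syntax; map₂)
open import Data.Sum.Base as Sum using (_⊎_; inj₁; inj₂; [_,_]′)
open import Data.Vec.Base as Vec using (Vec; []; _∷_; fromList; replicate)
open import Data.Vec.Membership.Propositional using () renaming (_∈_ to _∈ᵛ_)
open import Data.Vec.Membership.Propositional.Properties using (∈-fromList⁺)
open import Data.Vec.Properties using (map-cong; ∷-injective; ∷-injectiveˡ; ∷-injectiveʳ; ≡-dec)
open import Data.Vec.Relation.Unary.Any as AnyVec using ()
open import Function.Base using (_∘_; id)
open import Function.Bundles using (mk⇔)
open import Level using (0ℓ; lift; lower) renaming (suc to lsuc)
open import Relation.Binary.PropositionalEquality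
  using (_≡_; _≢_; refl; sym; trans; cong; cong₂; subst)
open import Relation.Nullary.Decidable using (Dec; yes; no; map′; ¬?; decidable-stable)
open import Relation.Nullary.Negation using (¬_; contradiction)
open import Relation.Unary using (Pred; _∈_; _∉_; _≐_; Satisfiable; Empty)
open import Defs

private variable
  A I : Set
  n   : ℕ

-- Finite lists and bit vectors

remove : {x : A} {xs : List A} → x ∈ˡ xs →
         ∃[ ys ] length xs ≡ suc (length ys) × (∀ {y} → y ∈ˡ xs → y ≢ x → y ∈ˡ ys)
remove {x = x} x∈xs with ys , zs , refl ← ∈-∃++ x∈xs =
  ys ++ zs , length-++-sucʳ ys x zs , λ y∈ y≢x → shrink y≢x (∈-++⁻ ys y∈)
  where
  shrink : ∀ {y} → y ≢ x → y ∈ˡ ys ⊎ y ∈ˡ x ∷ zs → y ∈ˡ ys ++ zs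
  shrink y≢x (inj₁ y∈ys)         = ∈-++⁺ˡ y∈ys
  shrink y≢x (inj₂ (here y≡x))   = contradiction y≡x y≢x
  shrink y≢x (inj₂ (there y∈zs)) = ∈-++⁺ʳ ys y∈zs

-- Pigeonhole, by deleting the head of `xs` from `ys`: uniqueness keeps the tail of `xs` away from
-- that head, so the tail survives the deletion.
Unique-⊆⇒length-≤ : {xs ys : List A} → Unique xs → (∀ {x} → x ∈ˡ xs → x ∈ˡ ys) →
                    length xs ≤ length ys
Unique-⊆⇒length-≤ []                  xs⊆ys = z≤n
Unique-⊆⇒length-≤ (x∉xs ∷ xs-unique) xs⊆ys with zs , eq , keep ← remove (xs⊆ys (here refl)) =
  ≤-trans (s≤s (Unique-⊆⇒length-≤ xs-unique λ y∈xs →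
            keep (xs⊆ys (there y∈xs)) λ y≡x → All.lookup x∉xs y∈xs (sym y≡x)))
          (≤-reflexive (sym eq))

powerset : List A → List (List A)
powerset []       = [ [] ]
powerset (x ∷ xs) = powerset xs ++ map (x ∷_) (powerset xs)

-- Lets quantifiers over sets of bit vectors range over one finite list: an image is a `filter` of
-- `bitVectors`, so it occurs there literally.
filter∈powerset : {P : Pred A 0ℓ} (P? : ∀ x → Dec (P x)) (xs : List A) →
                  filter P? xs ∈ˡ powerset xs
filter∈powerset P? []       = here refl
filter∈powerset P? (x ∷ xs) with P? x
... | yes _ = ∈-++⁺ʳ (powerset xs) (∈-map⁺ (x ∷_) (filter∈powerset P? xs))
... | no  _ = ∈-++⁺ˡ (filter∈powerset P? xs)

bitVectors : ∀ n → List (Vec Bool n)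
bitVectors zero    = [ [] ]
bitVectors (suc n) = map (false ∷_) (bitVectors n) ++ map (true ∷_) (bitVectors n)

∈-bitVectors : (v : Vec Bool n) → v ∈ˡ bitVectors n
∈-bitVectors []          = here refl
∈-bitVectors (false ∷ v) = ∈-++⁺ˡ (∈-map⁺ (false ∷_) (∈-bitVectors v))
∈-bitVectors (true ∷ v)  = ∈-++⁺ʳ _ (∈-map⁺ (true ∷_) (∈-bitVectors v))

_≟ᵛ_ : (v w : Vec Bool n) → Dec (v ≡ w)
_≟ᵛ_ = ≡-dec _≟ᵇ_

map-≡⇒≡ : {f g : A → Bool} {N : Vec A n} → Vec.map f N ≡ Vec.map g N →
          ∀ {i} → i ∈ᵛ N → f i ≡ g i
map-≡⇒≡ {N = _ ∷ _} eq (AnyVec.here refl) = ∷-injectiveˡ eq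
map-≡⇒≡ {N = _ ∷ _} eq (AnyVec.there i∈N) = map-≡⇒≡ (∷-injectiveʳ eq) i∈N

elements : (N : List ℕ) → List (Elem N)
elements []      = []
elements (i ∷ N) = (i , here refl) ∷ map (map₂ there) (elements N)

∈-elements : {N : List ℕ} (e : Elem N) → e ∈ˡ elements N
∈-elements (i , here refl) = here refl
∈-elements (i , there i∈N) = there (∈-map⁺ (map₂ there) (∈-elements (i , i∈N)))

-- Operations on teams

infixr 7 _∩ₜ_
infixr 6 _∪ₜ_

∅ₜ fullₜ : Team I
∅ₜ    = mkTeam (λ _ → false ≡ true) (λ _ ())
fullₜ = mkTeam (λ _ → true ≡ true) (λ _ → id)

singletonₜ : Valuation I → Team I
singletonₜ s = mkTeam (λ t → ∀ i → s i ≡ t i) (λ t≗u s≗t i → trans (s≗t i) (t≗u i))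

∁ₜ : Team I → Team I
∁ₜ X = mkTeam (λ s → s ∉ members X) (λ s≗t s∉X t∈X → s∉X (resp X (sym ∘ s≗t) t∈X))

_∩ₜ_ _∪ₜ_ : Team I → Team I → Team I
X ∩ₜ Y = mkTeam (λ s → s ∈ members X × s ∈ members Y)
                (λ s≗t (x , y) → resp X s≗t x , resp Y s≗t y)
X ∪ₜ Y = mkTeam (λ s → s ∈ members X ⊎ s ∈ members Y)
                (λ s≗t → Sum.map (resp X s≗t) (resp Y s≗t))

literal : I → Bool → Team I
literal i b = mkTeam (λ s → s i ≡ b) (λ s≗t si≡b → trans (sym (s≗t i)) si≡b)

preimage : Vec I n → Pred (Vec Bool n) 0ℓ → Team I
preimage N P = mkTeam (λ s → Vec.map s N ∈ P) (λ s≗t → subst P (map-cong s≗t N))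

-- Locality and the empty team

infix 4 _≼[_]_

-- Inclusion after restriction to `N`. It is weaker than `⊆ₜ`, so closure under it combines downward
-- closure with dependence on `N` alone.
_≼[_]_ : Team I → Vec I n → Team I → Set
Y ≼[ N ] X = ∀ {s} → s ∈ members Y → ∃[ t ] t ∈ members X × Vec.map s N ≡ Vec.map t N

⊆ₜ⇒≼ : {N : Vec I n} (X Y : Team I) → Y ⊆ₜ X → Y ≼[ N ] X
⊆ₜ⇒≼ X Y Y⊆X s∈Y = _ , Y⊆X s∈Y , refl

vars : Formula I → List I
vars (var i)    = [ i ]
vars (¬var i)   = [ i ]
vars bot        = []
vars (dep is j) = j ∷ is
vars (φ ∧ ψ)    = vars φ ++ vars ψ
vars (φ ⊗ ψ)    = vars φ ++ vars ψ
vars (φ ∨ ψ)    = vars φ ++ vars ψ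
vars (φ ⇒ ψ)    = vars φ ++ vars ψ

-- The largest team W with W ≼[ N ] Z.
below : (N : Vec I n) (Z : Team I) → Team I
below N Z = preimage N (λ v → ∃[ t ] t ∈ members Z × v ≡ Vec.map t N)

⊨-≼ : {N : Vec I n} {X Y : Team I} (φ : Formula I) → (∀ {i} → i ∈ˡ vars φ → i ∈ᵛ N) →
      Y ≼[ N ] X → X ⊨ φ → Y ⊨ φ
⊨-≼ (var i) ⊆N Y≼X (lift x) = lift λ s s∈Y →
  let t , t∈X , eq = Y≼X s∈Y in trans (map-≡⇒≡ eq (⊆N (here refl))) (x t t∈X)
⊨-≼ (¬var i) ⊆N Y≼X (lift x) = lift λ s s∈Y →
  let t , t∈X , eq = Y≼X s∈Y in trans (map-≡⇒≡ eq (⊆N (here refl))) (x t t∈X)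
⊨-≼ bot ⊆N Y≼X (lift x) = lift λ s s∈Y → let t , t∈X , _ = Y≼X s∈Y in x t t∈X
⊨-≼ (dep is j) ⊆N Y≼X (lift x) = lift λ s s′ s∈Y s′∈Y agree →
  let t  , t∈X  , eq  = Y≼X s∈Y
      t′ , t′∈X , eq′ = Y≼X s′∈Y
      j∈N = ⊆N (here refl)
  in trans (map-≡⇒≡ eq j∈N) (trans
       (x t t′ t∈X t′∈X (All.tabulate λ i∈is →
         let i∈N = ⊆N (there i∈is)
         in trans (sym (map-≡⇒≡ eq i∈N)) (trans (All.lookup agree i∈is) (map-≡⇒≡ eq′ i∈N))))
       (sym (map-≡⇒≡ eq′ j∈N)))
⊨-≼ (φ ∧ ψ) ⊆N Y≼X (x , y) =
  ⊨-≼ φ (⊆N ∘ ∈-++⁺ˡ) Y≼X x , ⊨-≼ ψ (⊆N ∘ ∈-++⁺ʳ (vars φ)) Y≼X y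
⊨-≼ {N = N} {Y = Y} (φ ⊗ ψ) ⊆N Y≼X (Z , W , Z⊆X , W⊆X , (X⊆Z∪W , _) , z , w) =
  -- The splitting of `X` is pulled back to `Y`: each valuation goes where its counterpart in `X`
  -- went.
  Y ∩ₜ below N Z , Y ∩ₜ below N W , proj₁ , proj₁ ,
  ((λ s∈Y → let t , t∈X , eq = Y≼X s∈Y in
     Sum.map (λ t∈Z → s∈Y , t , t∈Z , eq) (λ t∈W → s∈Y , t , t∈W , eq) (X⊆Z∪W t∈X)) ,
   [ proj₁ , proj₁ ]′) ,
  ⊨-≼ φ (⊆N ∘ ∈-++⁺ˡ) proj₂ z , ⊨-≼ ψ (⊆N ∘ ∈-++⁺ʳ (vars φ)) proj₂ w
⊨-≼ (φ ∨ ψ) ⊆N Y≼X =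
  Sum.map (⊨-≼ φ (⊆N ∘ ∈-++⁺ˡ) Y≼X) (⊨-≼ ψ (⊆N ∘ ∈-++⁺ʳ (vars φ)) Y≼X)
⊨-≼ {N = N} {X = X} (φ ⇒ ψ) ⊆N Y≼X x Z Z⊆Y z =
  -- The implication is applied to `X ∩ₜ below N Z`, which has exactly the vectors of `Z`, so truth
  -- of `φ` and `ψ` transfers in both directions.
  ⊨-≼ ψ (⊆N ∘ ∈-++⁺ʳ (vars φ))
    (λ s∈Z → let t , t∈X , eq = Y≼X (Z⊆Y s∈Z) in t , (t∈X , _ , s∈Z , sym eq) , eq)
    (x (X ∩ₜ below N Z) proj₁ (⊨-≼ φ (⊆N ∘ ∈-++⁺ˡ) proj₂ z))

⊨-⊆ₜ : {X Y : Team I} (φ : Formula I) → Y ⊆ₜ X → X ⊨ φ → Y ⊨ φ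
⊨-⊆ₜ {X = X} {Y} φ Y⊆X = ⊨-≼ φ ∈-fromList⁺ (⊆ₜ⇒≼ X Y Y⊆X)

-- The empty team property; it makes every definable family nonempty.
⊨-empty : {X : Team I} (φ : Formula I) → Empty (members X) → X ⊨ φ
⊨-empty (var i)    e = lift λ s s∈X → contradiction s∈X (e s)
⊨-empty (¬var i)   e = lift λ s s∈X → contradiction s∈X (e s)
⊨-empty bot        e = lift e
⊨-empty (dep is j) e = lift λ s _ s∈X → contradiction s∈X (e s)
⊨-empty (φ ∧ ψ)    e = ⊨-empty φ e , ⊨-empty ψ e
⊨-empty {X = X} (φ ⊗ ψ) e = X , X , id , id , (inj₁ , [ id , id ]′) , ⊨-empty φ e , ⊨-empty ψ e
⊨-empty (φ ∨ ψ)    e = inj₁ (⊨-empty φ e)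
⊨-empty (φ ⇒ ψ)    e = λ Y Y⊆X _ → ⊨-empty ψ (λ s s∈Y → e s (Y⊆X s∈Y))

-- Flat formulas

-- Such formulas are flat: truth in X is truth at each valuation of X.
infix 4 _Defines_

record _Defines_ (φ : Formula I) (T : Team I) : Set₁ where
  constructor mkDefines
  field
    to   : ∀ X → X ⊨ φ → X ⊆ₜ T
    from : ∀ X → X ⊆ₜ T → X ⊨ φ

open _Defines_

Defines-resp-≐ : {φ : Formula I} {S T : Team I} → members S ≐ members T →
                 φ Defines S → φ Defines T
Defines-resp-≐ (S⊆T , T⊆S) d = mkDefines
  (λ X x s∈X → S⊆T (to d X x s∈X))
  (λ X X⊆T → from d X λ s∈X → T⊆S (X⊆T s∈X))

var-defines : (i : I) → var i Defines literal i true
var-defines i = mkDefines (λ X (lift x) → x _) (λ X X⊆T → lift λ s → X⊆T)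

¬var-defines : (i : I) → ¬var i Defines literal i false
¬var-defines i = mkDefines (λ X (lift x) → x _) (λ X X⊆T → lift λ s → X⊆T)

bot-defines : bot Defines ∅ₜ {I}
bot-defines = mkDefines
  (λ X (lift x) s∈X → contradiction s∈X (x _))
  (λ X X⊆∅ → lift λ s s∈X → contradiction (X⊆∅ s∈X) λ ())

∧-defines : {φ ψ : Formula I} {S T : Team I} → φ Defines S → ψ Defines T → φ ∧ ψ Defines S ∩ₜ T
∧-defines d e = mkDefines
  (λ X (x , y) s∈X → to d X x s∈X , to e X y s∈X)
  (λ X X⊆S∩T → from d X (λ s∈X → proj₁ (X⊆S∩T s∈X)) , from e X (λ s∈X → proj₂ (X⊆S∩T s∈X)))

-- Between flat formulas `⊗` is classical disjunction: a team inside `S ∪ₜ T` splits into its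
-- intersections with `S` and `T`.
⊗-defines : {φ ψ : Formula I} {S T : Team I} → φ Defines S → ψ Defines T → φ ⊗ ψ Defines S ∪ₜ T
⊗-defines {S = S} {T} d e = mkDefines
  (λ X (Y , Z , _ , _ , (X⊆Y∪Z , _) , y , z) s∈X → Sum.map (to d Y y) (to e Z z) (X⊆Y∪Z s∈X))
  (λ X X⊆S∪T → X ∩ₜ S , X ∩ₜ T , proj₁ , proj₁ ,
     ((λ s∈X → Sum.map (s∈X ,_) (s∈X ,_) (X⊆S∪T s∈X)) , [ proj₁ , proj₁ ]′) ,
     from d _ proj₂ , from e _ proj₂)

⇒bot-defines : {φ : Formula I} {S : Team I} → φ Defines S → φ ⇒ bot Defines ∁ₜ S
⇒bot-defines {S = S} d = mkDefines
  -- The implication is tested on the singleton of `s`, a nonempty subteam of `X` that satisfies `φ`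
  -- as soon as `s` lies in `S`.
  (λ X x {s} s∈X s∈S → lower (x (singletonₜ s) (λ s≗t → resp X s≗t s∈X)
    (from d _ λ s≗t → resp S s≗t s∈S)) s λ _ → refl)
  (λ X X⊆∁S Y Y⊆X y → lift λ s s∈Y → X⊆∁S (Y⊆X s∈Y) (to d Y y s∈Y))

-- Finite connectives and membership in the languages

⋁ ⨂ : (A → Formula I) → List A → Formula I
⋁ f = foldr (λ x φ → f x ∨ φ) bot
⨂ f = foldr (λ x φ → f x ⊗ φ) bot

-- The base case is a parameter because truth is not primitive: it is built from `⊗` in some
-- languages and from `⇒` in others.
⋀ : Formula I → (A → Formula I) → List A → Formula I
⋀ ⊤ f = foldr (λ x φ → f x ∧ φ) ⊤

module _ {f : A → Formula I} {X : Team I} where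

  ⋁⁺ : {x : A} {xs : List A} → x ∈ˡ xs → X ⊨ f x → X ⊨ ⋁ f xs
  ⋁⁺ (here refl)  x = inj₁ x
  ⋁⁺ (there x∈xs) x = inj₂ (⋁⁺ x∈xs x)

  -- The case of an empty `X` stems from the `bot` that closes the disjunction.
  ⋁⁻ : (xs : List A) → X ⊨ ⋁ f xs → Empty (members X) ⊎ (∃[ x ] x ∈ˡ xs × X ⊨ f x)
  ⋁⁻ []       (lift e) = inj₁ e
  ⋁⁻ (x ∷ xs) (inj₁ p) = inj₂ (x , here refl , p)
  ⋁⁻ (x ∷ xs) (inj₂ p) = Sum.map₂ (λ (y , y∈xs , q) → y , there y∈xs , q) (⋁⁻ xs p)

  ⋀⁺ : {⊤ : Formula I} {xs : List A} → X ⊨ ⊤ → (∀ {x} → x ∈ˡ xs → X ⊨ f x) → X ⊨ ⋀ ⊤ f xs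
  ⋀⁺ {xs = []}     t p = t
  ⋀⁺ {xs = x ∷ xs} t p = p (here refl) , ⋀⁺ t (p ∘ there)

  ⋀⁻ : {⊤ : Formula I} {x : A} {xs : List A} → X ⊨ ⋀ ⊤ f xs → x ∈ˡ xs → X ⊨ f x
  ⋀⁻ (p , _) (here refl)  = p
  ⋀⁻ (_ , p) (there x∈xs) = ⋀⁻ p x∈xs

module _ (L : Logic) {f : A → Formula I} (f-inLang : ∀ x → f x inLang L) where

  ⋁-inLang : `bot ∈ˡ symbols L → `∨ ∈ˡ symbols L → ∀ xs → ⋁ f xs inLang L
  ⋁-inLang b o []       = b
  ⋁-inLang b o (x ∷ xs) = o , f-inLang x , ⋁-inLang b o xs

  ⨂-inLang : `bot ∈ˡ symbols L → `⊗ ∈ˡ symbols L → ∀ xs → ⨂ f xs inLang L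
  ⨂-inLang b o []       = b
  ⨂-inLang b o (x ∷ xs) = o , f-inLang x , ⨂-inLang b o xs

  ⋀-inLang : {⊤ : Formula I} → ⊤ inLang L → `∧ ∈ˡ symbols L → ∀ xs → ⋀ ⊤ f xs inLang L
  ⋀-inLang t o []       = t
  ⋀-inLang t o (x ∷ xs) = o , f-inLang x , ⋀-inLang t o xs

inLang-mono : {L L′ : Logic} → (∀ {σ} → σ ∈ˡ symbols L → σ ∈ˡ symbols L′) →
              (φ : Formula I) → φ inLang L → φ inLang L′
inLang-mono L⊆L′ (var _)   o           = L⊆L′ o
inLang-mono L⊆L′ (¬var _)  o           = L⊆L′ o
inLang-mono L⊆L′ bot       o           = L⊆L′ o
inLang-mono L⊆L′ (dep _ _) o           = L⊆L′ o
inLang-mono L⊆L′ (φ ∧ ψ)   (o , p , q) = L⊆L′ o , inLang-mono L⊆L′ φ p , inLang-mono L⊆L′ ψ q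
inLang-mono L⊆L′ (φ ⊗ ψ)   (o , p , q) = L⊆L′ o , inLang-mono L⊆L′ φ p , inLang-mono L⊆L′ ψ q
inLang-mono L⊆L′ (φ ∨ ψ)   (o , p , q) = L⊆L′ o , inLang-mono L⊆L′ φ p , inLang-mono L⊆L′ ψ q
inLang-mono L⊆L′ (φ ⇒ ψ)   (o , p , q) = L⊆L′ o , inLang-mono L⊆L′ φ p , inLang-mono L⊆L′ ψ q

pattern ∈₀ = here refl
pattern ∈₁ = there ∈₀
pattern ∈₂ = there ∈₁
pattern ∈₃ = there ∈₂
pattern ∈₄ = there ∈₃
pattern ∈₅ = there ∈₄
pattern ∈₆ = there ∈₅

PD∨⊆PT₀ : ∀ {σ} → σ ∈ˡ symbols PD∨ → σ ∈ˡ symbols PT₀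
PD∨⊆PT₀ = All.lookup {P = _∈ˡ symbols PT₀} (∈₀ ∷ ∈₁ ∷ ∈₂ ∷ ∈₄ ∷ ∈₅ ∷ ∈₆ ∷ [])

InqL⊆PID : ∀ {σ} → σ ∈ˡ symbols InqL → σ ∈ˡ symbols PID
InqL⊆PID = All.lookup {P = _∈ˡ symbols PID} (∈₀ ∷ ∈₁ ∷ ∈₃ ∷ ∈₄ ∷ ∈₅ ∷ [])

-- Formulas for single vectors

-- Negated variables and ⊤ are parameters because PD and InqL express them differently.
module Point (neg : I → Formula I) (⊤ : Formula I) where

  point : Vec I n → Vec Bool n → Formula I
  point []      []          = ⊤
  point (i ∷ N) (true ∷ v)  = var i ∧ point N v
  point (i ∷ N) (false ∷ v) = neg i ∧ point N v

  point-defines : (∀ i → neg i Defines literal i false) → ⊤ Defines fullₜ →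
                  (N : Vec I n) (v : Vec Bool n) → point N v Defines preimage N (_≡ v)
  point-defines dn dt []      []          = Defines-resp-≐ ((λ _ → refl) , (λ _ → refl)) dt
  point-defines dn dt (i ∷ N) (true ∷ v)  =
    Defines-resp-≐ ((λ (p , q) → cong₂ _∷_ p q) , ∷-injective)
      (∧-defines (var-defines i) (point-defines dn dt N v))
  point-defines dn dt (i ∷ N) (false ∷ v) =
    Defines-resp-≐ ((λ (p , q) → cong₂ _∷_ p q) , ∷-injective)
      (∧-defines (dn i) (point-defines dn dt N v))

  point-inLang : (L : Logic) → `var ∈ˡ symbols L → `∧ ∈ˡ symbols L →
                 (∀ i → neg i inLang L) → ⊤ inLang L →
                 (N : Vec I n) (v : Vec Bool n) → point N v inLang L
  point-inLang L p o g t []      []          = t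
  point-inLang L p o g t (i ∷ N) (true ∷ v)  = o , p , point-inLang L p o g t N v
  point-inLang L p o g t (i ∷ N) (false ∷ v) = o , g i , point-inLang L p o g t N v

-- With no premises, `dep [] i` is the constancy atom, so the conjunction allows at most one vector
-- over `N`.
constant : Formula I → Vec I n → Formula I
constant ⊤ []      = ⊤
constant ⊤ (i ∷ N) = dep [] i ∧ constant ⊤ N

constant⁻ : {⊤ : Formula I} {X : Team I} (N : Vec I n) → X ⊨ constant ⊤ N →
            ∀ {s t} → s ∈ members X → t ∈ members X → Vec.map s N ≡ Vec.map t N
constant⁻ []      x            s∈X t∈X = refl
constant⁻ (i ∷ N) (lift x , y) s∈X t∈X = cong₂ _∷_ (x _ _ s∈X t∈X []) (constant⁻ N y s∈X t∈X)

constant⁺ : {⊤ : Formula I} {X : Team I} (N : Vec I n) → X ⊨ ⊤ →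
            (∀ {s t} → s ∈ members X → t ∈ members X → Vec.map s N ≡ Vec.map t N) →
            X ⊨ constant ⊤ N
constant⁺ []      t eq = t
constant⁺ (i ∷ N) t eq =
  lift (λ _ _ s∈X t∈X _ → ∷-injectiveˡ (eq s∈X t∈X)) ,
  constant⁺ N t (λ s∈X t∈X → ∷-injectiveʳ (eq s∈X t∈X))

constant-inLang : (L : Logic) → `dep ∈ˡ symbols L → `∧ ∈ˡ symbols L →
                  {⊤ : Formula I} → ⊤ inLang L → (N : Vec I n) → constant ⊤ N inLang L
constant-inLang L d o t []      = t
constant-inLang L d o t (i ∷ N) = o , d , constant-inLang L d o t N

-- Normal forms over a fixed tuple of variables

module Complete (em : ExcludedMiddle (lsuc 0ℓ)) {I : Set} (i₀ : I) {n : ℕ} (N : Vec I n) where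

  -- Excluded middle is assumed one level up, where truth and membership in a family live; small
  -- propositions are lifted to it.
  dec : (P : Set) → Dec P
  dec P = map′ lower lift em

  _∈?_ : (v : Vec Bool n) (T : List (Vec Bool n)) → Dec (v ∈ˡ T)
  v ∈? T = dec (v ∈ˡ T)

  others : List (Vec Bool n) → List (Vec Bool n)
  others T = filter (λ v → ¬? (v ∈? T)) (bitVectors n)

  ∈-others⁺ : ∀ {T v} → v ∉ˡ T → v ∈ˡ others T
  ∈-others⁺ = ∈-filter⁺ _ (∈-bitVectors _)

  ∈-others⁻ : ∀ {T v} → v ∈ˡ others T → v ∉ˡ T
  ∈-others⁻ {T} v∈ = proj₂ (∈-filter⁻ (λ v → ¬? (v ∈? T)) {xs = bitVectors n} v∈)

  [_]ₜ : List (Vec Bool n) → Team I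
  [ T ]ₜ = preimage N (_∈ˡ T)

  image : Team I → List (Vec Bool n)
  image X = filter (λ v → dec (∃[ t ] t ∈ members X × v ≡ Vec.map t N)) (bitVectors n)

  ∈-image⁺ : (X : Team I) → ∀ {s} → s ∈ members X → Vec.map s N ∈ˡ image X
  ∈-image⁺ X s∈X = ∈-filter⁺ _ (∈-bitVectors _) (_ , s∈X , refl)

  ∈-image⁻ : (X : Team I) → ∀ {v} → v ∈ˡ image X → ∃[ t ] t ∈ members X × v ≡ Vec.map t N
  ∈-image⁻ X v∈ = proj₂
    (∈-filter⁻ (λ v → dec (∃[ t ] t ∈ members X × v ≡ Vec.map t N)) {xs = bitVectors n} v∈)

  Local : Pred (Pred (Team I) (lsuc 0ℓ)) (lsuc 0ℓ)
  Local 𝒦 = ∀ X Y → Y ≼[ N ] X → X ∈ 𝒦 → Y ∈ 𝒦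

  -- Truth in the `⊗` fragment takes a variable. As `N` may be empty, `i₀` is supplied separately.
  ⊤⊗ : Formula I
  ⊤⊗ = var i₀ ⊗ ¬var i₀

  ⊤⊗-defines : ⊤⊗ Defines fullₜ
  ⊤⊗-defines = Defines-resp-≐ ((λ _ → refl) , λ {s} _ → bool (s i₀))
    (⊗-defines (var-defines i₀) (¬var-defines i₀))
    where
    bool : ∀ b → b ≡ true ⊎ b ≡ false
    bool true  = inj₁ refl
    bool false = inj₂ refl

  module ⊗-Point = Point ¬var ⊤⊗

  cover⊗ : List (Vec Bool n) → Formula I
  cover⊗ = ⨂ (⊗-Point.point N)

  cover⊗-defines : ∀ T → cover⊗ T Defines [ T ]ₜ
  cover⊗-defines []      = Defines-resp-≐ ((λ ()) , λ ()) bot-defines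
  cover⊗-defines (v ∷ T) = Defines-resp-≐
    ([ here , there ]′ , λ { (here eq) → inj₁ eq ; (there v∈T) → inj₂ v∈T })
    (⊗-defines (⊗-Point.point-defines ¬var-defines ⊤⊗-defines N v) (cover⊗-defines T))

  -- The symbols behind `cover⊗`, which `PD` and `PD∨` share.
  ⊗-Fragment : Logic → Set
  ⊗-Fragment L = All (_∈ˡ symbols L) (`var ∷ `¬var ∷ `bot ∷ `∧ ∷ `⊗ ∷ [])

  ⊤⊗-inLang : (L : Logic) → ⊗-Fragment L → ⊤⊗ inLang L
  ⊤⊗-inLang L (v ∷ nv ∷ _ ∷ _ ∷ t ∷ []) = t , v , nv

  cover⊗-inLang : (L : Logic) → ⊗-Fragment L → ∀ T → cover⊗ T inLang L
  cover⊗-inLang L fragment@(v ∷ nv ∷ b ∷ a ∷ t ∷ []) =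
    ⨂-inLang L (⊗-Point.point-inLang L v a (λ _ → nv) (⊤⊗-inLang L fragment) N) b t

  ⊤⇒ : Formula I
  ⊤⇒ = bot ⇒ bot

  ⊤⇒-defines : ⊤⇒ Defines fullₜ
  ⊤⇒-defines = Defines-resp-≐ ((λ _ → refl) , λ _ ()) (⇒bot-defines bot-defines)

  neg⇒ : I → Formula I
  neg⇒ i = var i ⇒ bot

  neg⇒-defines : ∀ i → neg⇒ i Defines literal i false
  neg⇒-defines i = Defines-resp-≐ (¬-not , λ eq eq′ → not-¬ eq eq′) (⇒bot-defines (var-defines i))

  module ⇒-Point = Point neg⇒ ⊤⇒

  avoids : Vec Bool n → Formula I
  avoids v = ⇒-Point.point N v ⇒ bot

  avoids-defines : ∀ v → avoids v Defines ∁ₜ (preimage N (_≡ v))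
  avoids-defines v = ⇒bot-defines (⇒-Point.point-defines neg⇒-defines ⊤⇒-defines N v)

  -- In the absence of `⊗`, inclusion in `[ T ]ₜ` is expressed dually: every vector outside `T` is
  -- avoided.
  cover⇒ : List (Vec Bool n) → Formula I
  cover⇒ T = ⋀ ⊤⇒ avoids (others T)

  cover⇒-defines : ∀ T → cover⇒ T Defines [ T ]ₜ
  cover⇒-defines T = mkDefines
    (λ X x {s} s∈X → decidable-stable (_ ∈? T) λ s∉T →
      to (avoids-defines (Vec.map s N)) X (⋀⁻ x (∈-others⁺ s∉T)) s∈X refl)
    (λ X X⊆T → ⋀⁺ {f = avoids} {⊤ = ⊤⇒} {others T} (from ⊤⇒-defines X λ _ → refl) λ {v} v∈ →
      from (avoids-defines v) X λ { s∈X refl → ∈-others⁻ {T} v∈ (X⊆T s∈X) })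

  cover⇒-inLang : ∀ T → cover⇒ T inLang InqL
  cover⇒-inLang T =
    ⋀-inLang InqL
      (λ v → ∈₄ , ⇒-Point.point-inLang InqL ∈₀ ∈₂ (λ _ → ∈₄ , ∈₀ , ∈₁) ⊤⇒-inLang N v , ∈₁)
      ⊤⇒-inLang ∈₂ (others T)
    where
    ⊤⇒-inLang : ⊤⇒ inLang InqL
    ⊤⇒-inLang = ∈₄ , ∈₁ , ∈₁

  -- Counting vectors and missing a vector

  atMost : ℕ → Formula I
  atMost zero    = bot
  atMost (suc k) = constant ⊤⊗ N ⊗ atMost k

  ⊨⊤⊗ : (X : Team I) → X ⊨ ⊤⊗
  ⊨⊤⊗ X = from ⊤⊗-defines X λ _ → refl

  atMost⁺ : (X : Team I) (T : List (Vec Bool n)) → X ⊆ₜ [ T ]ₜ → X ⊨ atMost (length T)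
  atMost⁺ X []      X⊆T = lift λ s s∈X → contradiction (X⊆T s∈X) λ ()
  atMost⁺ X (v ∷ T) X⊆T =
    Y , Z , proj₁ , proj₁ ,
    ((λ s∈X → split s∈X (X⊆T s∈X)) , [ proj₁ , proj₁ ]′) ,
    constant⁺ N (⊨⊤⊗ Y) (λ (_ , p) (_ , q) → trans p (sym q)) ,
    atMost⁺ Z T proj₂
    where
    Y = X ∩ₜ preimage N (_≡ v)
    Z = X ∩ₜ [ T ]ₜ
    split : ∀ {s} → s ∈ members X → Vec.map s N ∈ˡ v ∷ T → s ∈ members Y ⊎ s ∈ members Z
    split s∈X (here eq)   = inj₁ (s∈X , eq)
    split s∈X (there v∈T) = inj₂ (s∈X , v∈T)

  constantValue : (X : Team I) → X ⊨ constant ⊤⊗ N →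
                  ∃[ v ] (∀ {s} → s ∈ members X → Vec.map s N ≡ v)
  constantValue X x with dec (Satisfiable (members X))
  ... | yes (t , t∈X) = _ , λ s∈X → constant⁻ N x s∈X t∈X
  -- An empty part may be given any vector; the dummy keeps the list in `atMost⁻` at length exactly
  -- `k`.
  ... | no  ¬sat      = replicate _ false , λ s∈X → contradiction (_ , s∈X) ¬sat

  atMost⁻ : (X : Team I) (k : ℕ) → X ⊨ atMost k →
            ∃[ T ] length T ≡ k × X ⊆ₜ [ T ]ₜ
  atMost⁻ X zero    (lift e) = [] , refl , λ s∈X → contradiction s∈X (e _)
  atMost⁻ X (suc k) (Y , Z , _ , _ , (X⊆Y∪Z , _) , y , z)
    with v , Y≡v ← constantValue Y y | T , eq , Z⊆T ← atMost⁻ Z k z =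
    v ∷ T , cong suc eq , λ s∈X → [ here ∘ Y≡v , there ∘ Z⊆T ]′ (X⊆Y∪Z s∈X)

  -- Meaningless for T = [], where pred truncates.
  misses : List (Vec Bool n) → Formula I
  misses T = atMost (pred (length (deduplicate _≟ᵛ_ T))) ⊗ cover⊗ (others T)

  misses⁺ : (X : Team I) (T : List (Vec Bool n)) →
            ¬ (∀ {v} → v ∈ˡ T → v ∈ˡ image X) → X ⊨ misses T
  misses⁺ X T T⊈X with dec (∃[ v ] v ∈ˡ T × v ∉ˡ image X)
  ... | no ∄v = contradiction
    (λ {v} v∈T → decidable-stable (v ∈? image X) λ v∉X → ∄v (_ , v∈T , v∉X)) T⊈X
  -- Deleting the missed `v` from the deduplicated `T` leaves `U`, one shorter, which still covers
  -- the part of `X` with vectors in `T`.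
  ... | yes (v , v∈T , v∉X) with U , eq , keep ← remove (∈-deduplicate⁺ _≟ᵛ_ v∈T) =
    Y , Z , proj₁ , proj₁ , ((λ s∈X → split s∈X (_ ∈? T)) , [ proj₁ , proj₁ ]′) ,
    subst (λ k → Y ⊨ atMost k) (sym (cong pred eq)) (atMost⁺ Y U λ (s∈X , s∈T) →
      keep (∈-deduplicate⁺ _≟ᵛ_ s∈T) λ { refl → v∉X (∈-image⁺ X s∈X) }) ,
    from (cover⊗-defines (others T)) Z proj₂
    where
    Y = X ∩ₜ [ T ]ₜ
    Z = X ∩ₜ [ others T ]ₜ
    split : ∀ {s} → s ∈ members X → Dec (Vec.map s N ∈ˡ T) → s ∈ members Y ⊎ s ∈ members Z
    split s∈X (yes s∈T) = inj₁ (s∈X , s∈T)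
    split s∈X (no s∉T)  = inj₂ (s∈X , ∈-others⁺ s∉T)

  -- If all of `T` occurred in `X`, no vector of `T` could come from `Z`, so `Y` would contain every
  -- one of them: more distinct vectors than `atMost` permits.
  misses⁻ : (X : Team I) (T : List (Vec Bool n)) → T ≢ [] → X ⊨ misses T →
            ¬ (∀ {v} → v ∈ˡ T → v ∈ˡ image X)
  misses⁻ X []      T≢[] _ _ = contradiction refl T≢[]
  -- With `T` a cons, the deduplicated length is a successor, so `pred` truly subtracts one and
  -- `1+n≰n` applies.
  misses⁻ X T@(_ ∷ _) _ (Y , Z , _ , _ , (X⊆Y∪Z , _) , y , z) T⊆X
    with U , eq , Y⊆U ← atMost⁻ Y _ y =
    1+n≰n (≤-trans (Unique-⊆⇒length-≤ (deduplicate-! _≟ᵛ_ T) T⊆U) (≤-reflexive eq))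
    where
    T⊆U : ∀ {v} → v ∈ˡ deduplicate _≟ᵛ_ T → v ∈ˡ U
    T⊆U v∈ with t , t∈X , refl ← ∈-image⁻ X (T⊆X (∈-deduplicate⁻ _≟ᵛ_ T v∈)) =
      [ Y⊆U
      , (λ t∈Z → contradiction (∈-deduplicate⁻ _≟ᵛ_ T v∈)
                   (∈-others⁻ {T} (to (cover⊗-defines (others T)) Z z t∈Z)))
      ]′ (X⊆Y∪Z t∈X)

  misses-inLang : ∀ T → misses T inLang PD
  misses-inLang T = ∈₅ , atMost-inLang _ , cover⊗-inLang PD PD-fragment (others T)
    where
    PD-fragment = ∈₀ ∷ ∈₁ ∷ ∈₂ ∷ ∈₄ ∷ ∈₅ ∷ []
    atMost-inLang : ∀ k → atMost k inLang PD
    atMost-inLang zero    = ∈₂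
    atMost-inLang (suc k) =
      ∈₅ , constant-inLang PD ∈₃ ∈₄ (⊤⊗-inLang PD PD-fragment) N , atMost-inLang k

  -- Disjunctive and conjunctive forms of a local family

  module _ {𝒦 : Pred (Team I) (lsuc 0ℓ)} (sat : Satisfiable 𝒦) (local : Local 𝒦) where

    empty∈𝒦 : (X : Team I) → Empty (members X) → X ∈ 𝒦
    empty∈𝒦 X e = local _ _ (λ s∈X → contradiction s∈X (e _)) (proj₂ sat)

    inside outside : List (List (Vec Bool n))
    inside  = filter (λ T → em {[ T ]ₜ ∈ 𝒦}) (powerset (bitVectors n))
    outside = filter (λ T → ¬? (em {[ T ]ₜ ∈ 𝒦})) (powerset (bitVectors n))

    disjunctiveForm : (List (Vec Bool n) → Formula I) → Formula I
    disjunctiveForm cover = ⋁ cover inside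

    -- A team `X` in the family satisfies the disjunct for `image X`, because `X` and `[ image X ]ₜ`
    -- have the same vectors. Conversely, a true disjunct places `X` inside a member of the family.
    disjunctiveForm-correct : {cover : List (Vec Bool n) → Formula I} →
                              (∀ T → cover T Defines [ T ]ₜ) → 𝒦 ≐ ⟦ disjunctiveForm cover ⟧
    disjunctiveForm-correct defines =
      (λ {X} X∈𝒦 → ⋁⁺ {xs = inside}
         (∈-filter⁺ _ (filter∈powerset _ (bitVectors n)) (local X _ (∈-image⁻ X) X∈𝒦))
         (from (defines (image X)) X (∈-image⁺ X))) ,
      (λ {X} x → [ empty∈𝒦 X
                 , (λ (T , T∈ , p) → local _ X (⊆ₜ⇒≼ [ T ]ₜ X (to (defines T) X p))
                     (proj₂ (∈-filter⁻ (λ T → em {[ T ]ₜ ∈ 𝒦}) {xs = powerset (bitVectors n)} T∈)))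
                 ]′ (⋁⁻ inside x))

    conjunctiveForm : Formula I
    conjunctiveForm = ⋀ ⊤⊗ misses outside

    -- If `X` in the family had all vectors of an outside `T`, locality would put `[ T ]ₜ` in it
    -- too. Conversely, were `image X` outside, `X` would have to miss a vector of its own image.
    conjunctiveForm-correct : 𝒦 ≐ ⟦ conjunctiveForm ⟧
    conjunctiveForm-correct =
      (λ {X} X∈𝒦 → ⋀⁺ {f = misses} {⊤ = ⊤⊗} {outside} (⊨⊤⊗ X) λ {T} T∈ →
         let T∉𝒦 = proj₂ (∈-filter⁻ (λ T → ¬? (em {[ T ]ₜ ∈ 𝒦})) {xs = powerset (bitVectors n)} T∈)
         in misses⁺ X T λ T⊆X → T∉𝒦 (local X _ (λ s∈T → ∈-image⁻ X (T⊆X s∈T)) X∈𝒦)) ,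
      (λ {X} x → local _ X (⊆ₜ⇒≼ [ image X ]ₜ X (∈-image⁺ X))
         (decidable-stable em λ image∉𝒦 →
            misses⁻ X (image X)
              -- An empty image is never outside, since the family contains the empty team; this
              -- excludes the degenerate `misses []`.
              (λ image≡[] → image∉𝒦 (empty∈𝒦 _ (λ s → subst (Vec.map s N ∉ˡ_) (sym image≡[]) λ ())))
              (⋀⁻ x (∈-filter⁺ _ (filter∈powerset _ (bitVectors n)) image∉𝒦)) id))

    definable : (L : Logic) → ∃[ φ ] φ inLang L × 𝒦 ≐ ⟦ φ ⟧
    definable PD   =
      conjunctiveForm ,
      ⋀-inLang PD {f = misses} misses-inLang {⊤⊗} (∈₅ , ∈₀ , ∈₁) ∈₄ outside ,
      conjunctiveForm-correct
    definable PD∨  =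
      disjunctiveForm cover⊗ ,
      ⋁-inLang PD∨ (cover⊗-inLang PD∨ (∈₀ ∷ ∈₁ ∷ ∈₂ ∷ ∈₃ ∷ ∈₄ ∷ [])) ∈₂ ∈₅ inside ,
      disjunctiveForm-correct cover⊗-defines
    definable InqL =
      disjunctiveForm cover⇒ ,
      ⋁-inLang InqL cover⇒-inLang ∈₁ ∈₃ inside ,
      disjunctiveForm-correct cover⇒-defines
    definable PT₀ with φ , φ∈PD∨  , eq ← definable PD∨  = φ , inLang-mono PD∨⊆PT₀ φ φ∈PD∨ , eq
    definable PID with φ , φ∈InqL , eq ← definable InqL = φ , inLang-mono InqL⊆PID φ φ∈InqL , eq

-- Expressive completeness and translations

module _ (em : ExcludedMiddle (lsuc 0ℓ)) where

  expressivelyComplete : (L : Logic) → ExpressivelyComplete L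
  expressivelyComplete L []          _ N≢[] = contradiction refl N≢[]
  expressivelyComplete L N@(i ∷ _) _ _     =
    (λ (sat , downward) → definable sat
       -- The tuple lists all of `Elem N`, so equal vectors mean pointwise equal valuations; by
       -- `resp`, `≼` is then plain inclusion and downward closure suffices.
       (λ X Y Y≼X → downward X Y λ s∈Y → let t , t∈X , eq = Y≼X s∈Y in
         resp X (λ e → sym (map-≡⇒≡ eq (∈-fromList⁺ (∈-elements e)))) t∈X) L) ,
    (λ (φ , _ , 𝒦⊆φ , φ⊆𝒦) →
       (∅ₜ , φ⊆𝒦 (⊨-empty φ λ _ ())) ,
       λ X Y Y⊆X X∈𝒦 → φ⊆𝒦 (⊨-⊆ₜ {X = X} φ Y⊆X (𝒦⊆φ X∈𝒦)))
    where open Complete em (i , here refl) (fromList (elements N))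

  -- By `⊨-≼`, the teams on ℕ satisfying `φ` form a local family over `vars φ`, so the normal forms
  -- apply to them directly.
  translate : (L : Logic) (φ : Formula ℕ) → ∃[ ψ ] ψ inLang L × φ ≡ₛ ψ
  translate L φ =
    let ψ , ψ∈L , φ⊆ψ , ψ⊆φ =
          definable (∅ₜ , ⊨-empty φ λ _ ()) (λ X Y → ⊨-≼ φ ∈-fromList⁺) L
    in ψ , ψ∈L , λ X → mk⇔ φ⊆ψ ψ⊆φ
    -- The index 0 is an arbitrary choice for `i₀`, as `vars φ` may be empty.
    where open Complete em 0 (fromList (vars φ))

theorem1p7 : ExcludedMiddle (lsuc 0ℓ) →
    ((L : Logic) → ExpressivelyComplete L) ×
    ((L₁ L₂ : Logic) → L₁ ≡ᴸ L₂)
theorem1p7 em = expressivelyComplete em ,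
  λ L₁ L₂ → (λ φ _ → translate em L₂ φ) , (λ ψ _ → translate em L₁ ψ)
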